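{- Let $p\ge 3$ be a prime and let $m,\alpha,\beta\ge 1$ be integers with $2\nmid\alpha$. (i) If $\bar a_{2^m\alpha}(p)\equiv 0\pmod 2$, then for all integers $n,k\ge 0$ with $p\nmid(2n+1)$, $$\bar a_{2^m\alpha}\left(2p^{2k+1}n+p^{2k+1}\right)\equiv 0\pmod{2^{m+2}}.$$ (ii) If $\bar a_{2\beta+1}(p)\equiv 0\pmod 2$, then for all integers $n,k\ge 0$ with $p\nmid(2n+1)$, $$\bar a_{2\beta+1}\left(2p^{2k+1}n+p^{2k+1}\right)\equiv 0\pmod 4.$$
   Context: For integers $\ell\ge1$ write $f_\ell=\prod_{j\ge 1}(1-q^{\ell j})$. For a positive integer $s$, $\bar a_s(n)$ denotes the number of partitions of $n$ in which each odd part occurs in one of $s$ colors and the first occurrence of each part (parts of the same size but different colors being distinct) may be overlined. Equivalently, $$\sum_{n\ge0}\bar a_s(n)q^n=\frac{f_2^{3s-2}}{f_1^{2s}f_4^{s-1}}.$$ -}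

module Defs where

open import Data.Bool using (Bool; true; false; if_then_else_)
import Data.Bool as Bool
open import Data.List using (List; []; _∷_; length; map; filter; upTo; cartesianProduct; cartesianProductWith)
open import Data.List.Membership.Propositional using (_∈_)
open import Data.List.Membership.Propositional.Properties
  using (∈-cartesianProduct⁺; ∈-cartesianProductWith⁺; ∈-cartesianProductWith⁻; ∈-filter⁺; ∈-filter⁻; ∈-upTo⁺)
open import Data.List.Properties using (∷-injective)
open import Data.List.Relation.Unary.All using (All; []; _∷_; all?)
import Data.List.Relation.Unary.All as All
open import Data.List.Relation.Unary.Any using (here; there)
open import Data.List.Relation.Unary.Linked using (Linked; linked?)
open import Data.List.Relation.Unary.Unique.Propositional using (Unique; []; _∷_)
import Data.List.Relation.Unary.Unique.Propositional.Properties as Unique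
open import Data.Nat using (ℕ; zero; suc; _+_; _≤_; _<_; s≤s; z≤n; _≤?_; _<?_; _≟_)
open import Data.Nat.Divisibility using (_∣?_)
open import Data.Nat.ListAction using (sum)
open import Data.Nat.Properties using (≤-trans; ≤-reflexive; m≤m+n; m≤n+m; +-mono-≤; n≤1+n)
open import Data.Product using (_×_; _,_; proj₁; proj₂)
open import Data.Sum using (_⊎_)
open import Function.Bundles using (_⇔_; mk⇔)
open import Relation.Binary.PropositionalEquality using (_≡_; refl)
open import Relation.Nullary using (Dec; does)
open import Relation.Nullary.Decidable using (_×-dec_; _⊎-dec_)

-- One occurrence of a part: its size, its colour, and whether it is overlined.
Part : Set
Part = ℕ × ℕ × Bool

size : Part → ℕ
size = proj₁

-- The colours available to parts of size j are 0, …, colours s j ∸ 1.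
colours : ℕ → ℕ → ℕ
colours s j = if does (2 ∣? j) then 1 else s

ValidPart : ℕ → Part → Set
ValidPart s (j , c , _) = 1 ≤ j × c < colours s j

-- A partition is listed in weakly decreasing lexicographic order of
-- (size , colour).  Equal parts are then consecutive, so an entry repeats an
-- earlier part exactly when it repeats the entry just before it; such an entry
-- must not be overlined, whereas a first occurrence may or may not be.
_MayPrecede_ : Part → Part → Set
(j , c , _) MayPrecede (j′ , c′ , o′) =
  j′ < j ⊎ (j′ ≡ j × c′ < c) ⊎ (j′ ≡ j × c′ ≡ c × o′ ≡ false)

IsOverpartition : ℕ → ℕ → List Part → Set
IsOverpartition s n xs =
  All (ValidPart s) xs × Linked _MayPrecede_ xs × sum (map size xs) ≡ n

validPart? : ∀ s x → Dec (ValidPart s x)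
validPart? s (j , c , _) = (1 ≤? j) ×-dec (c <? colours s j)

mayPrecede? : ∀ x y → Dec (x MayPrecede y)
mayPrecede? (j , c , _) (j′ , c′ , o′) =
  (j′ <? j) ⊎-dec ((j′ ≟ j) ×-dec (c′ <? c))
  ⊎-dec ((j′ ≟ j) ×-dec (c′ ≟ c) ×-dec (o′ Bool.≟ false))

isOverpartition? : ∀ s n xs → Dec (IsOverpartition s n xs)
isOverpartition? s n xs =
  all? (validPart? s) xs ×-dec linked? mayPrecede? xs ×-dec (sum (map size xs) ≟ n)

listsUpTo : ∀ {A : Set} → ℕ → List A → List (List A)
listsUpTo zero    as = [] ∷ []
listsUpTo (suc k) as = [] ∷ cartesianProductWith _∷_ as (listsUpTo k as)

-- The search space is only a finite box containing all the overpartitions of n,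
-- as ∈-overpartitions shows; in particular it holds more colours than needed.
partsUpTo : ℕ → ℕ → List Part
partsUpTo s n =
  cartesianProduct (upTo (suc n)) (cartesianProduct (upTo (suc s)) (true ∷ false ∷ []))

overpartitions : ℕ → ℕ → List (List Part)
overpartitions s n = filter (isOverpartition? s n) (listsUpTo n (partsUpTo s n))

ā : ℕ → ℕ → ℕ
ā s n = length (overpartitions s n)

listsUpTo-unique : ∀ {A : Set} k {as : List A} → Unique as → Unique (listsUpTo k as)
listsUpTo-unique zero    u = [] ∷ []
listsUpTo-unique (suc k) {as} u =
  All.tabulate nonempty ∷ Unique.cartesianProductWith⁺ _∷_ ∷-injective u (listsUpTo-unique k u)
  where
  nonempty : ∀ {ys} → ys ∈ cartesianProductWith _∷_ as (listsUpTo k as) → [] ≡ ys → _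
  nonempty ys∈ refl with ∈-cartesianProductWith⁻ _∷_ as (listsUpTo k as) ys∈
  ... | _ , _ , _ , _ , ()

overpartitions-unique : ∀ s n → Unique (overpartitions s n)
overpartitions-unique s n =
  Unique.filter⁺ (isOverpartition? s n) (listsUpTo-unique n
    (Unique.cartesianProduct⁺ (Unique.upTo⁺ (suc n))
      (Unique.cartesianProduct⁺ (Unique.upTo⁺ (suc s)) (((λ ()) ∷ []) ∷ [] ∷ []))))

∈-listsUpTo : ∀ {A : Set} {as : List A} {k xs} →
              length xs ≤ k → All (_∈ as) xs → xs ∈ listsUpTo k as
∈-listsUpTo {k = zero}  z≤n     []         = here refl
∈-listsUpTo {k = suc k} z≤n     []         = here refl
∈-listsUpTo {k = suc k} (s≤s l) (x∈ ∷ xs∈) =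
  there (∈-cartesianProductWith⁺ _∷_ x∈ (∈-listsUpTo l xs∈))

colours≤ : ∀ s j → colours s j ≤ suc s
colours≤ s j with does (2 ∣? j)
... | true  = s≤s z≤n
... | false = n≤1+n s

length≤sum : ∀ {s xs} → All (ValidPart s) xs → length xs ≤ sum (map size xs)
length≤sum []              = z≤n
length≤sum ((1≤j , _) ∷ v) = +-mono-≤ 1≤j (length≤sum v)

∈-partsUpTo : ∀ {s n xs} → All (ValidPart s) xs → sum (map size xs) ≤ n →
              All (_∈ partsUpTo s n) xs
∈-partsUpTo [] _ = []
∈-partsUpTo {s} {xs = (j , c , o) ∷ xs} ((_ , c<) ∷ v) le =
  ∈-cartesianProduct⁺ (∈-upTo⁺ (s≤s (≤-trans (m≤m+n j _) le)))
    (∈-cartesianProduct⁺ (∈-upTo⁺ (≤-trans c< (colours≤ s j))) (∈-bools o))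
  ∷ ∈-partsUpTo v (≤-trans (m≤n+m _ j) le)
  where
  ∈-bools : ∀ b → b ∈ true ∷ false ∷ []
  ∈-bools true  = here refl
  ∈-bools false = there (here refl)

∈-overpartitions : ∀ s n xs → xs ∈ overpartitions s n ⇔ IsOverpartition s n xs
∈-overpartitions s n xs = mk⇔
  (λ xs∈ → proj₂ (∈-filter⁻ (isOverpartition? s n) {xs = listsUpTo n (partsUpTo s n)} xs∈))
  (λ (v , l , eq) → ∈-filter⁺ (isOverpartition? s n)
    (∈-listsUpTo (≤-trans (length≤sum v) (≤-reflexive eq)) (∈-partsUpTo v (≤-reflexive eq)))
    (v , l , eq))

{-# OPTIONS --safe #-}

-- Grouping a partition by its distinct (size, colour) pairs gives the generating function
-- O^s E with O = ∏ (1 + 2 x_j) over odd j, E = ∏ (1 + 2 x_j) over even j and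
-- x_j = q^j / (1 - q^j).  Put N = p^(2k+1) (2n+1), which is odd and not a square.
-- Modulo 4, O is 1 + 2 Σ x_j, whose N-th coefficient is twice the number of divisors of N,
-- hence 0.  If f = 1 + 2^r g with r ≥ 1 and g_N even, then f² = 1 + 2^(r+1) (g + 2^(r-1) g²),
-- and (g²)_N is even because N is odd; so O^(2^m a) is 1 mod 2^(m+1) with N-th coefficient
-- 0 mod 2^(m+2).  Since E ≡ 1 mod 2 involves only even powers of q, the factor E does not
-- change this.  Part (ii) is the case m = 0.
module Submission where

open import Defs
open import Algebra.Bundles using (CommutativeSemiring)
import Algebra.Solver.Ring.NaturalCoefficients.Default
open import Data.List using (List; []; _∷_; foldr)
open import Data.Product using (_×_; _,_; ∃; proj₁; proj₂)

-- Identities for products of factors 1 + kx.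

module Binomial {c ℓ} (R : CommutativeSemiring c ℓ) where
  open CommutativeSemiring R
  open Algebra.Solver.Ring.NaturalCoefficients.Default R

  2# : Carrier
  2# = 1# + 1#

  1+k*-mul : ∀ k x y → (1# + k * x) * (1# + k * y) ≈ 1# + k * (x + y + k * (x * y))
  1+k*-mul = solve 3 (λ k x y →
    (con 1 :+ k :* x) :* (con 1 :+ k :* y) := con 1 :+ k :* (x :+ y :+ k :* (x :* y))) refl

  -- The cross term doubles the modulus 2k, and the square term 4k²x² = 4k · kx² is a multiple of 4k
  -- as well.
  1+2k*-square : ∀ k x → (1# + 2# * k * x) * (1# + 2# * k * x) ≈
                         1# + 2# * (2# * k) * (x + k * (x * x))
  1+2k*-square = solve 2 (λ k x → let 2:# = con 1 :+ con 1 in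
    (con 1 :+ 2:# :* k :* x) :* (con 1 :+ 2:# :* k :* x) :=
    con 1 :+ 2:# :* (2:# :* k) :* (x :+ k :* (x :* x))) refl

  -- Every term of the expansion with at least two factors 2x is a multiple of 4; `y` collects these
  -- terms, so modulo 4 only the sum remains.
  ∏-1+2* : ∀ xs → ∃ λ y →
    foldr (λ x z → (1# + 2# * x) * z) 1# xs ≈ 1# + 2# * (foldr _+_ 0# xs + 2# * y)
  ∏-1+2* []       = 0# , solve 0 (let 2:# = con 1 :+ con 1 in
    con 1 := con 1 :+ 2:# :* (con 0 :+ 2:# :* con 0)) refl
  ∏-1+2* (x ∷ xs) = let y , eq = ∏-1+2* xs in
    -- The new multiples of 4 arise from 2x times the part of the remaining product beyond 1.
    y + x * (foldr _+_ 0# xs + 2# * y) ,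
    trans (*-congˡ eq) (solve 3 (λ x s y → let 2:# = con 1 :+ con 1 in
      (con 1 :+ 2:# :* x) :* (con 1 :+ 2:# :* (s :+ 2:# :* y)) :=
      con 1 :+ 2:# :* (x :+ s :+ 2:# :* (y :+ x :* (s :+ 2:# :* y)))) refl
      x (foldr _+_ 0# xs) y)

open import Algebra.Structures.Biased using (isCommutativeSemiringˡ)
open import Data.Bool using (true; false; if_then_else_)
open import Data.List
  using (_++_; map; filter; downFrom; length; replicate; cartesianProductWith)
open import Data.List.Membership.Propositional using (_∈_)
open import Data.List.Membership.Propositional.Properties
open import Data.List.Membership.Propositional.Properties.WithK using (unique∧set⇒bag)
open import Data.List.Properties
  using (length-++; length-map; map-++; ++-cancelˡ; ∷-injective; filter-accept; filter-reject)
open import Data.List.Relation.Binary.BagAndSetEquality using (∼bag⇒↭)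
open import Data.List.Relation.Binary.Permutation.Propositional.Properties using (↭-length)
open import Data.List.Relation.Unary.All as All using (All; []; _∷_)
import Data.List.Relation.Unary.All.Properties as All
open import Data.List.Relation.Unary.AllPairs using (AllPairs; []; _∷_)
import Data.List.Relation.Unary.AllPairs.Properties as AllPairs
open import Data.List.Relation.Unary.Any using (here; there)
open import Data.List.Relation.Unary.Linked.Properties using (AllPairs⇒Linked; Linked⇒AllPairs)
open import Data.List.Relation.Unary.Unique.Propositional using (Unique)
import Data.List.Relation.Unary.Unique.Propositional.Properties as Unique
open import Data.Nat using (ℕ; zero; suc; _+_; _*_; _^_; _≤_; _<_; s≤s; z≤n; _≟_; >-nonZero)
open import Data.Nat.Divisibility
open import Data.Nat.ListAction using (sum)
open import Data.Nat.ListAction.Properties using (sum-++)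
open import Data.Nat.Primality
  using (Prime; prime[2]; euclidsLemma; prime⇒nonZero; prime⇒irreducible)
open import Data.Nat.Properties
open import Data.Nat.Solver using (module +-*-Solver)
open import Data.Sum using (_⊎_; inj₁; inj₂; [_,_]′)
open import Function using (_∘_; id)
open import Function.Bundles using (Equivalence; mk⇔)
open import Level using (0ℓ)
open import Relation.Binary.Bundles using (Setoid)
open import Relation.Binary.PropositionalEquality
import Relation.Binary.Reasoning.Setoid as ≈-Reasoning
open import Relation.Nullary using (¬_; Dec; yes; no; does; contradiction; ¬?)
open import Relation.Nullary.Decidable using (dec-true; dec-false)
open +-*-Solver using (solve; _:+_; _:*_; _:=_; con)

-- The semiring of power series over the natural numbers.

Series : Set
Series = ℕ → ℕ

_⊕_ : Series → Series → Series
(f ⊕ g) n = f n + g n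

-- The Cauchy product, written as a recursion that shifts `f`; this avoids finite sums and
-- subtraction of indices.
_⊛_ : Series → Series → Series
(f ⊛ g) zero    = f 0 * g 0
(f ⊛ g) (suc n) = f 0 * g (suc n) + ((f ∘ suc) ⊛ g) n

𝟘 𝟙 : Series
𝟘 _ = 0
𝟙 zero    = 1
𝟙 (suc _) = 0

⊛-cong : ∀ {f f′ g g′} → f ≗ f′ → g ≗ g′ → f ⊛ g ≗ f′ ⊛ g′
⊛-cong p q zero    = cong₂ _*_ (p 0) (q 0)
⊛-cong p q (suc n) = cong₂ _+_ (cong₂ _*_ (p 0) (q (suc n))) (⊛-cong (p ∘ suc) q n)

-- The defining recursion splits off the term with `f 0`; commutativity needs the term with `g 0`
-- split off instead.
⊛-suc : ∀ f g n → (f ⊛ g) (suc n) ≡ (f ⊛ (g ∘ suc)) n + f (suc n) * g 0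
⊛-suc f g zero    = refl
⊛-suc f g (suc n) = trans (cong (f 0 * g (2 + n) +_) (⊛-suc (f ∘ suc) g n))
  (sym (+-assoc (f 0 * g (2 + n)) _ _))

⊛-comm : ∀ f g → f ⊛ g ≗ g ⊛ f
⊛-comm f g zero    = *-comm (f 0) (g 0)
⊛-comm f g (suc n) = begin
  f 0 * g (suc n) + ((f ∘ suc) ⊛ g) n ≡⟨ cong₂ _+_ (*-comm (f 0) _) (⊛-comm (f ∘ suc) g n) ⟩
  g (suc n) * f 0 + (g ⊛ (f ∘ suc)) n ≡⟨ +-comm (g (suc n) * f 0) _ ⟩
  (g ⊛ (f ∘ suc)) n + g (suc n) * f 0 ≡⟨ ⊛-suc g f n ⟨
  (g ⊛ f) (suc n)                     ∎
  where open ≡-Reasoning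

⊛-distribʳ : ∀ h f g → (f ⊕ g) ⊛ h ≗ (f ⊛ h) ⊕ (g ⊛ h)
⊛-distribʳ h f g zero    = *-distribʳ-+ (h 0) (f 0) (g 0)
⊛-distribʳ h f g (suc n) = trans
  (cong ((f 0 + g 0) * h (suc n) +_) (⊛-distribʳ h (f ∘ suc) (g ∘ suc) n))
  (solve 5 (λ a b c d e → (a :+ b) :* c :+ (d :+ e) := a :* c :+ d :+ (b :* c :+ e)) refl
    (f 0) (g 0) (h (suc n)) (((f ∘ suc) ⊛ h) n) (((g ∘ suc) ⊛ h) n))

⊛-scaleˡ : ∀ k f g n → ((λ i → k * f i) ⊛ g) n ≡ k * (f ⊛ g) n
⊛-scaleˡ k f g zero    = *-assoc k (f 0) (g 0)
⊛-scaleˡ k f g (suc n) = trans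
  (cong₂ _+_ (*-assoc k (f 0) _) (⊛-scaleˡ k (f ∘ suc) g n))
  (sym (*-distribˡ-+ k (f 0 * g (suc n)) _))

⊛-assoc : ∀ f g h → (f ⊛ g) ⊛ h ≗ f ⊛ (g ⊛ h)
⊛-assoc f g h zero    = *-assoc (f 0) (g 0) (h 0)
⊛-assoc f g h (suc n) = begin
  f 0 * g 0 * h (suc n) + (((f ⊛ g) ∘ suc) ⊛ h) n
    ≡⟨ cong (f 0 * g 0 * h (suc n) +_)
         (⊛-distribʳ h (λ i → f 0 * g (suc i)) ((f ∘ suc) ⊛ g) n) ⟩
  f 0 * g 0 * h (suc n) + (((λ i → f 0 * g (suc i)) ⊛ h) n + (((f ∘ suc) ⊛ g) ⊛ h) n)
    ≡⟨ cong₂ (λ u v → f 0 * g 0 * h (suc n) + (u + v))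
         (⊛-scaleˡ (f 0) (g ∘ suc) h n) (⊛-assoc (f ∘ suc) g h n) ⟩
  f 0 * g 0 * h (suc n) + (f 0 * ((g ∘ suc) ⊛ h) n + ((f ∘ suc) ⊛ (g ⊛ h)) n)
    ≡⟨ solve 5 (λ a b c d e → a :* b :* c :+ (a :* d :+ e) := a :* (b :* c :+ d) :+ e) refl
         (f 0) (g 0) (h (suc n)) (((g ∘ suc) ⊛ h) n) (((f ∘ suc) ⊛ (g ⊛ h)) n) ⟩
  f 0 * (g ⊛ h) (suc n) + ((f ∘ suc) ⊛ (g ⊛ h)) n ∎
  where open ≡-Reasoning

⊛-zeroˡ : ∀ f → 𝟘 ⊛ f ≗ 𝟘
⊛-zeroˡ f zero    = refl
⊛-zeroˡ f (suc n) = ⊛-zeroˡ f n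

⊛-identityˡ : ∀ f → 𝟙 ⊛ f ≗ f
⊛-identityˡ f zero    = +-identityʳ (f 0)
⊛-identityˡ f (suc n) = trans (cong₂ _+_ (+-identityʳ (f (suc n))) (⊛-zeroˡ f n)) (+-identityʳ _)

seriesSemiring : CommutativeSemiring 0ℓ 0ℓ
seriesSemiring = record
  { Carrier = Series ; _≈_ = _≗_ ; _+_ = _⊕_ ; _*_ = _⊛_ ; 0# = 𝟘 ; 1# = 𝟙
  ; isCommutativeSemiring = isCommutativeSemiringˡ record
    { +-isCommutativeMonoid = record
      { isMonoid = record
        { isSemigroup = record
          { isMagma = record
            { isEquivalence = ≗-isEq
            ; ∙-cong = λ p q n → cong₂ _+_ (p n) (q n) }
          ; assoc = λ f g h n → +-assoc (f n) (g n) (h n) }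
        ; identity = (λ f n → refl) , (λ f n → +-identityʳ (f n)) }
      ; comm = λ f g n → +-comm (f n) (g n) }
    ; *-isCommutativeMonoid = record
      { isMonoid = record
        { isSemigroup = record
          { isMagma = record { isEquivalence = ≗-isEq ; ∙-cong = ⊛-cong }
          ; assoc = ⊛-assoc }
        ; identity = ⊛-identityˡ , (λ f n → trans (⊛-comm f 𝟙 n) (⊛-identityˡ f n)) }
      ; comm = ⊛-comm }
    ; distribʳ = ⊛-distribʳ
    ; zeroˡ = ⊛-zeroˡ
    }
  }
  where
  ≗-isEq = Setoid.isEquivalence (ℕ →-setoid ℕ)

module 𝕊 = CommutativeSemiring seriesSemiring
open Binomial seriesSemiring using (2#; 1+k*-mul; 1+2k*-square; ∏-1+2*)
open import Algebra.Properties.CommutativeSemiring.Exp seriesSemiring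
  using (^-congʳ; ^-assocʳ; ^-distrib-*) renaming (_^_ to _^^_)
open import Algebra.Properties.CommutativeSemigroup 𝕊.*-commutativeSemigroup using (x∙yz≈y∙xz)

-- Coefficients modulo powers of 2.

2#-coeff : ∀ g n → (2# ⊛ g) n ≡ 2 * g n
2#-coeff g n = trans (⊛-distribʳ g 𝟙 𝟙 n) (cong₂ _+_ (⊛-identityˡ g n)
  (trans (⊛-identityˡ g n) (sym (+-identityʳ (g n)))))

2#^-coeff : ∀ r g n → ((2# ^^ r) ⊛ g) n ≡ 2 ^ r * g n
2#^-coeff zero    g n = trans (⊛-identityˡ g n) (sym (+-identityʳ (g n)))
2#^-coeff (suc r) g n = begin
  ((2# ⊛ (2# ^^ r)) ⊛ g) n ≡⟨ ⊛-assoc 2# (2# ^^ r) g n ⟩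
  (2# ⊛ ((2# ^^ r) ⊛ g)) n ≡⟨ 2#-coeff ((2# ^^ r) ⊛ g) n ⟩
  2 * ((2# ^^ r) ⊛ g) n    ≡⟨ cong (2 *_) (2#^-coeff r g n) ⟩
  2 * (2 ^ r * g n)        ≡⟨ *-assoc 2 (2 ^ r) (g n) ⟨
  2 ^ suc r * g n          ∎
  where open ≡-Reasoning

2∣n+n : ∀ n → 2 ∣ n + n
2∣n+n n = subst (λ m → 2 ∣ n + m) (+-identityʳ n) (m∣m*n n)

-- The terms `f i * f k` and `f k * f i` pair up, and there is no middle term because `n` is odd.
-- Each recursive step removes the outermost pair.
⊛-square-even : ∀ f n → 2 ∤ n → 2 ∣ (f ⊛ f) n
⊛-square-even f zero          odd = contradiction (2 ∣0) odd
⊛-square-even f (suc zero)    odd =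
  subst (λ m → 2 ∣ f 0 * f 1 + m) (*-comm (f 0) (f 1)) (2∣n+n (f 0 * f 1))
⊛-square-even f (suc (suc n)) odd = subst (2 ∣_) (sym eq)
  (∣m∣n⇒∣m+n (2∣n+n (f 0 * f (2 + n)))
    (⊛-square-even (f ∘ suc) n (odd ∘ ∣m∣n⇒∣m+n ∣-refl)))
  where
  open ≡-Reasoning
  eq : (f ⊛ f) (2 + n) ≡ (f 0 * f (2 + n) + f 0 * f (2 + n)) + ((f ∘ suc) ⊛ (f ∘ suc)) n
  eq = begin
    f 0 * f (2 + n) + ((f ∘ suc) ⊛ f) (suc n)
      ≡⟨ cong (f 0 * f (2 + n) +_) (⊛-comm (f ∘ suc) f (suc n)) ⟩
    f 0 * f (2 + n) + (f 0 * f (2 + n) + ((f ∘ suc) ⊛ (f ∘ suc)) n)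
      ≡⟨ +-assoc (f 0 * f (2 + n)) _ _ ⟨
    (f 0 * f (2 + n) + f 0 * f (2 + n)) + ((f ∘ suc) ⊛ (f ∘ suc)) n ∎

⊛-vanishes : ∀ f g n → (∀ i k → i + k ≡ n → f i * g k ≡ 0) → (f ⊛ g) n ≡ 0
⊛-vanishes f g zero    h = h 0 0 refl
⊛-vanishes f g (suc n) h = cong₂ _+_ (h 0 (suc n) refl)
  (⊛-vanishes (f ∘ suc) g n λ i k eq → h (suc i) k (cong suc eq))

EvenSupported : Series → Set
EvenSupported f = ∀ n → 2 ∤ n → f n ≡ 0

-- If `i + k` is odd, one of `i` and `k` is odd, so every term of the convolution has a zero factor.
⊛-evenSupported : ∀ {f g} → EvenSupported f → EvenSupported g → EvenSupported (f ⊛ g)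
⊛-evenSupported {f} {g} ef eg n odd = ⊛-vanishes f g n vanish
  where
  vanish : ∀ i k → i + k ≡ n → f i * g k ≡ 0
  vanish i k refl with 2 ∣? i
  ... | no  2∤i = cong (_* g k) (ef i 2∤i)
  ... | yes 2∣i = trans (cong (f i *_) (eg k (odd ∘ ∣m∣n⇒∣m+n 2∣i))) (*-zeroʳ (f i))

-- Besides f ≡ 1 (mod 2^(r+1)), the N-th coefficient (N ≥ 1) of f is required to vanish
-- mod 2^(r+2).  For odd N squaring then raises r, as (g²)_N is even.
record Congruent1 (N r : ℕ) (f : Series) : Set where
  constructor congruent1
  field
    quotient   : Series
    expansion  : f ≗ 𝟙 ⊕ ((2# ^^ suc r) ⊛ quotient)
    even-at-N  : 2 ∣ quotient N

module _ {N : ℕ} where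

  congruent1-𝟙 : ∀ r → Congruent1 N r 𝟙
  congruent1-𝟙 r = congruent1 𝟘
    (λ n → sym (trans (cong (𝟙 n +_) (𝕊.zeroʳ (2# ^^ suc r) n)) (+-identityʳ (𝟙 n)))) (2 ∣0)

  congruent1-⊛ : ∀ {r f f′} → Congruent1 N r f → Congruent1 N r f′ → Congruent1 N r (f ⊛ f′)
  congruent1-⊛ {r} (congruent1 g eq 2∣g) (congruent1 g′ eq′ 2∣g′) = congruent1 _
    (𝕊.trans (⊛-cong eq eq′) (1+k*-mul (2# ^^ suc r) g g′))
    (∣m∣n⇒∣m+n (∣m∣n⇒∣m+n 2∣g 2∣g′)
      -- The cross term carries the factor 2^(r+1), hence is even at `N` whatever (g g′)_N is.
      (subst (2 ∣_) (sym (2#^-coeff (suc r) (g ⊛ g′) N))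
        (∣m⇒∣m*n ((g ⊛ g′) N) (m∣m*n (2 ^ r)))))

  congruent1-square : ∀ {r f} → 2 ∤ N → Congruent1 N r f → Congruent1 N (suc r) (f ⊛ f)
  congruent1-square {r} odd (congruent1 g eq 2∣g) = congruent1 _
    (𝕊.trans (⊛-cong eq eq) (1+2k*-square (2# ^^ r) g))
    -- The parity of (g²)_N settles every `r`, including `r = 0`, where the factor 2^r is odd.
    (∣m∣n⇒∣m+n 2∣g (subst (2 ∣_) (sym (2#^-coeff r (g ⊛ g) N))
      (∣n⇒∣m*n (2 ^ r) (⊛-square-even g N odd))))

  congruent1-resp : ∀ {r f f′} → f ≗ f′ → Congruent1 N r f → Congruent1 N r f′
  congruent1-resp f≗f′ (congruent1 g eq 2∣g) = congruent1 g (𝕊.trans (𝕊.sym f≗f′) eq) 2∣g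

  congruent1-^ : ∀ {r f} a → Congruent1 N r f → Congruent1 N r (f ^^ a)
  congruent1-^ zero    c = congruent1-𝟙 _
  congruent1-^ (suc a) c = congruent1-⊛ c (congruent1-^ a c)

  congruent1-^2^ : ∀ {f} m → 2 ∤ N → Congruent1 N 0 f → Congruent1 N m (f ^^ (2 ^ m))
  congruent1-^2^ {f} zero    odd c = congruent1-resp (𝕊.sym (𝕊.*-identityʳ f)) c
  congruent1-^2^ {f} (suc m) odd c = congruent1-resp
    (λ n → begin
      (h ⊛ h) n            ≡⟨ ⊛-cong {h} (λ _ → refl) (𝕊.sym (𝕊.*-identityʳ h)) n ⟩
      (h ^^ 2) n           ≡⟨ ^-assocʳ f (2 ^ m) 2 n ⟩
      (f ^^ (2 ^ m * 2)) n ≡⟨ ^-congʳ f (*-comm (2 ^ m) 2) n ⟩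
      (f ^^ (2 ^ suc m)) n ∎)
    (congruent1-square odd (congruent1-^2^ m odd c))
    where
    open ≡-Reasoning
    h = f ^^ (2 ^ m)

  -- With E = 1 + 2e the product is E + 2^(r+1) g E. At the odd index `N` the first summand
  -- vanishes, and (gE)_N = g_N + 2 (eg)_N is even.
  congruent1-coeff : ∀ {r f e} → 2 ∤ N → Congruent1 N r f → EvenSupported (𝟙 ⊕ (2# ⊛ e)) →
                     2 ^ (2 + r) ∣ (f ⊛ (𝟙 ⊕ (2# ⊛ e))) N
  congruent1-coeff {r} {f} {e} odd (congruent1 g eq 2∣g) even =
    subst (2 ^ (2 + r) ∣_) (sym lem)
      (subst (_∣ 2 ^ suc r * h N) (*-comm (2 ^ suc r) 2) (*-monoʳ-∣ (2 ^ suc r) 2∣h))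
    where
    open ≡-Reasoning
    E h : Series
    E = 𝟙 ⊕ (2# ⊛ e)
    h = g ⊛ E
    2∣h : 2 ∣ h N
    2∣h = subst (2 ∣_) (sym (𝕊.trans (𝕊.distribˡ g 𝟙 (2# ⊛ e))
        (λ n → cong₂ _+_ (𝕊.*-identityʳ g n)
          (trans (⊛-comm g (2# ⊛ e) n) (trans (⊛-assoc 2# e g n) (2#-coeff (e ⊛ g) n)))) N))
      (∣m∣n⇒∣m+n 2∣g (m∣m*n ((e ⊛ g) N)))
    lem : (f ⊛ E) N ≡ 2 ^ suc r * h N
    lem = begin
      (f ⊛ E) N                             ≡⟨ ⊛-cong eq (λ _ → refl) N ⟩
      ((𝟙 ⊕ ((2# ^^ suc r) ⊛ g)) ⊛ E) N      ≡⟨ ⊛-distribʳ E 𝟙 ((2# ^^ suc r) ⊛ g) N ⟩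
      (𝟙 ⊛ E) N + (((2# ^^ suc r) ⊛ g) ⊛ E) N
        ≡⟨ cong₂ _+_ (trans (⊛-identityˡ E N) (even N odd)) (⊛-assoc (2# ^^ suc r) g E N) ⟩
      ((2# ^^ suc r) ⊛ h) N                 ≡⟨ 2#^-coeff (suc r) h N ⟩
      2 ^ suc r * h N                       ∎

-- Finite sums and the parity of the number of divisors.

indicator : ∀ {P : Set} → Dec P → ℕ
indicator P? = if does P? then 1 else 0

indicator-yes : ∀ {P : Set} (P? : Dec P) → P → indicator P? ≡ 1
indicator-yes P? p = cong (if_then 1 else 0) (dec-true P? p)

indicator-no : ∀ {P : Set} (P? : Dec P) → ¬ P → indicator P? ≡ 0
indicator-no P? ¬p = cong (if_then 1 else 0) (dec-false P? ¬p)

Σ< : ℕ → (ℕ → ℕ) → ℕ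
Σ< zero    f = 0
Σ< (suc n) f = f n + Σ< n f

Σ<-cong : ∀ n {f g : ℕ → ℕ} → (∀ i → f i ≡ g i) → Σ< n f ≡ Σ< n g
Σ<-cong zero    f≗g = refl
Σ<-cong (suc n) f≗g = cong₂ _+_ (f≗g n) (Σ<-cong n f≗g)

Σ<-+ : ∀ n f g → Σ< n (λ i → f i + g i) ≡ Σ< n f + Σ< n g
Σ<-+ zero    f g = refl
Σ<-+ (suc n) f g = trans (cong (f n + g n +_) (Σ<-+ n f g))
  (solve 4 (λ a b c d → a :+ b :+ (c :+ d) := a :+ c :+ (b :+ d)) refl
    (f n) (g n) (Σ< n f) (Σ< n g))

Σ<-zero : ∀ n {f} → (∀ i → i < n → f i ≡ 0) → Σ< n f ≡ 0
Σ<-zero zero    h = refl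
Σ<-zero (suc n) h = cong₂ _+_ (h n ≤-refl) (Σ<-zero n λ i i<n → h i (m<n⇒m<1+n i<n))

Σ<-indicator : ∀ {P : ℕ → Set} (P? : ∀ i → Dec (P i)) {n q} → q < n → P q →
               (∀ {i} → P i → i ≡ q) → Σ< n (λ i → indicator (P? i)) ≡ 1
Σ<-indicator P? {suc n} {q} q<1+n Pq unique with n ≟ q
... | yes refl = cong₂ _+_ (indicator-yes (P? n) Pq)
      (Σ<-zero n λ i i<n → indicator-no (P? i) λ Pi → <⇒≢ i<n (unique Pi))
... | no n≢q   = cong₂ _+_ (indicator-no (P? n) (n≢q ∘ unique))
      (Σ<-indicator P? (≤∧≢⇒< (≤-pred q<1+n) (n≢q ∘ sym)) Pq unique)

-- Entries off the diagonal come in equal pairs. The induction splits off the last row and column,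
-- whose sums agree outside the corner.
Σ<-symmetric-even : ∀ n (g : ℕ → ℕ → ℕ) → (∀ i j → g i j ≡ g j i) → (∀ i → 2 ∣ g i i) →
                    2 ∣ Σ< n λ i → Σ< n (g i)
Σ<-symmetric-even zero    g g-sym diag = 2 ∣0
Σ<-symmetric-even (suc n) g g-sym diag = subst (2 ∣_) (sym eq)
  (∣m∣n⇒∣m+n (∣m∣n⇒∣m+n (diag n) (2∣n+n (Σ< n (g n)))) (Σ<-symmetric-even n g g-sym diag))
  where
  open ≡-Reasoning
  S = Σ< n λ i → Σ< n (g i)
  eq : (g n n + Σ< n (g n)) + Σ< n (λ i → g i n + Σ< n (g i)) ≡
       g n n + (Σ< n (g n) + Σ< n (g n)) + S
  eq = begin
    (g n n + Σ< n (g n)) + Σ< n (λ i → g i n + Σ< n (g i))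
      ≡⟨ cong (g n n + Σ< n (g n) +_) (Σ<-+ n (λ i → g i n) λ i → Σ< n (g i)) ⟩
    (g n n + Σ< n (g n)) + (Σ< n (λ i → g i n) + S)
      ≡⟨ cong (λ u → (g n n + Σ< n (g n)) + (u + S)) (Σ<-cong n λ i → g-sym i n) ⟩
    (g n n + Σ< n (g n)) + (Σ< n (g n) + S)
      ≡⟨ solve 3 (λ a b c → a :+ b :+ (b :+ c) := a :+ (b :+ b) :+ c) refl
           (g n n) (Σ< n (g n)) S ⟩
    g n n + (Σ< n (g n) + Σ< n (g n)) + S ∎

-- A divisor has exactly one cofactor, which lies in the range of summation. This turns the number
-- of divisors into a double sum that is symmetric in the two factors.
divisor-indicator : ∀ a n → indicator (suc a ∣? suc n) ≡
                    Σ< (suc n) λ b → indicator (suc a * suc b ≟ suc n)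
divisor-indicator a n with suc a ∣? suc n
... | yes d@(divides (suc q) eq) = trans (indicator-yes (suc a ∣? suc n) d)
        (sym (Σ<-indicator (λ b → suc a * suc b ≟ suc n)
          (subst (suc q ≤_) (sym eq) (m≤m*n (suc q) (suc a)))
          (trans (*-comm (suc a) (suc q)) (sym eq))
          (λ {b} eq′ → suc-injective (*-cancelˡ-≡ (suc b) (suc q) (suc a)
            (trans eq′ (trans eq (*-comm (suc q) (suc a))))))))
... | no ∤ = trans (indicator-no (suc a ∣? suc n) ∤) (sym (Σ<-zero (suc n) λ b _ →
        indicator-no (suc a * suc b ≟ suc n) λ eq →
          ∤ (divides (suc b) (trans (sym eq) (*-comm (suc a) (suc b))))))

-- Swapping a divisor with its cofactor is the symmetry of the double sum; a nonzero diagonal entry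
-- would exhibit `suc n` as a square.
nonsquare-even-divisors : ∀ n → (∀ a → a * a ≢ suc n) →
                          2 ∣ Σ< (suc n) λ a → indicator (suc a ∣? suc n)
nonsquare-even-divisors n nonsquare = subst (2 ∣_)
  (sym (Σ<-cong (suc n) λ a → divisor-indicator a n))
  (Σ<-symmetric-even (suc n) (λ a b → indicator (suc a * suc b ≟ suc n))
    (λ a b → cong (λ u → indicator (u ≟ suc n)) (*-comm (suc a) (suc b)))
    (λ a → subst (2 ∣_) (sym (indicator-no (suc a * suc a ≟ suc n) (nonsquare (suc a)))) (2 ∣0)))

-- Products over the odd and the even part sizes.

odd? : (j : ℕ) → Dec (2 ∤ j)
odd? j = ¬? (2 ∣? j)

-- The series q^j / (1 - q^j).
multiples : ℕ → Series
multiples j zero    = 0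
multiples j (suc n) = indicator (j ∣? suc n)

-- Each factor is 1 + 2 q^j / (1 - q^j) = (1 + q^j) / (1 - q^j), the overpartition generating
-- function of a single size and colour.
∏[1+2_] : List ℕ → Series
∏[1+2 js ] = foldr (λ f z → (𝟙 ⊕ (2# ⊛ f)) ⊛ z) 𝟙 (map multiples js)

sizes : ℕ → List ℕ
sizes b = map suc (downFrom b)

∑ : List Series → Series
∑ = foldr _⊕_ 𝟘

-- An even `j` divides no odd `n`, so the even sizes contribute nothing.
∑-odd-multiples : ∀ js n → 2 ∤ n → ∑ (map multiples (filter odd? js)) n ≡ ∑ (map multiples js) n
∑-odd-multiples js zero odd = contradiction (2 ∣0) odd
∑-odd-multiples []       (suc n) odd = refl
∑-odd-multiples (j ∷ js) (suc n) odd with 2 ∣? j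
... | no  2∤j rewrite filter-accept odd? {xs = js} 2∤j =
  cong (indicator (j ∣? suc n) +_) (∑-odd-multiples js (suc n) odd)
... | yes 2∣j rewrite filter-reject odd? {xs = js} (λ 2∤j → 2∤j 2∣j) =
  trans (∑-odd-multiples js (suc n) odd)
  (cong (_+ ∑ (map multiples js) (suc n)) (sym (indicator-no (j ∣? suc n) (odd ∘ ∣-trans 2∣j))))

∑-multiples : ∀ b n → ∑ (map multiples (sizes b)) (suc n) ≡ Σ< b λ a → indicator (suc a ∣? suc n)
∑-multiples zero    n = refl
∑-multiples (suc b) n = cong (indicator (suc b ∣? suc n) +_) (∑-multiples b n)

∏-odd-congruent1 : ∀ N → 2 ∤ N → (∀ a → a * a ≢ N) →
                   Congruent1 N 0 ∏[1+2 filter odd? (sizes N) ]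
∏-odd-congruent1 zero    odd nonsquare = contradiction (2 ∣0) odd
∏-odd-congruent1 (suc n) odd nonsquare = congruent1 (S ⊕ (2# ⊛ y))
  -- The power `2# ^^ 1` unfolds to `2# ⊛ 𝟙`, which has to be identified with `2#`.
  (𝕊.trans eq λ i → cong (𝟙 i +_) (⊛-cong (𝕊.sym (𝕊.*-identityʳ 2#)) (λ _ → refl) i))
  (∣m∣n⇒∣m+n
    (subst (2 ∣_) (sym (trans (∑-odd-multiples (sizes (suc n)) (suc n) odd)
                            (∑-multiples (suc n) n)))
      (nonsquare-even-divisors n nonsquare))
    (subst (2 ∣_) (sym (2#-coeff y (suc n))) (m∣m*n (y (suc n)))))
  where
  xs = map multiples (filter odd? (sizes (suc n)))
  S y : Series
  S = ∑ xs
  y = proj₁ (∏-1+2* xs)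
  eq = proj₂ (∏-1+2* xs)

1+2multiples-evenSupported : ∀ {j} → 2 ∣ j → EvenSupported (𝟙 ⊕ (2# ⊛ multiples j))
1+2multiples-evenSupported 2∣j zero odd = contradiction (2 ∣0) odd
1+2multiples-evenSupported {j} 2∣j (suc n) odd = trans (2#-coeff (multiples j) (suc n))
  (cong (2 *_) (indicator-no (j ∣? suc n) (odd ∘ ∣-trans 2∣j)))

∏-evenSupported : ∀ {js} → All (2 ∣_) js → EvenSupported ∏[1+2 js ]
∏-evenSupported []       zero    odd = contradiction (2 ∣0) odd
∏-evenSupported []       (suc n) odd = refl
∏-evenSupported (p ∷ ps) = ⊛-evenSupported (1+2multiples-evenSupported p) (∏-evenSupported ps)

-- Numbers exactly divisible by an odd power of a prime.

-- Descent on `k`: `p` divides `a`, and cancelling p² lowers the exponent by 2, until exponent 1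
-- forces `p` to divide `m`.
p^odd*m-nonsquare : ∀ {p m} → Prime p → p ∤ m → ∀ k a → a * a ≢ p ^ (2 * k + 1) * m
p^odd*m-nonsquare {p} {m} pp p∤m k a eq with p∣a
  where
  p∣a : p ∣ a
  p∣a = [ id , id ]′ (euclidsLemma a a pp
    (subst (p ∣_) (sym eq) (∣m⇒∣m*n m
      (subst (λ e → p ∣ p ^ e) (+-comm 1 (2 * k)) (m∣m*n (p ^ (2 * k)))))))
p^odd*m-nonsquare {p} {m} pp p∤m k _ eq | divides c refl = descend k (begin
  p * (c * c * p)
    ≡⟨ solve 2 (λ p c → p :* (c :* c :* p) := c :* p :* (c :* p)) refl p c ⟩
  c * p * (c * p)          ≡⟨ eq ⟩
  p ^ (2 * k + 1) * m      ≡⟨ cong (λ e → p ^ e * m) (+-comm (2 * k) 1) ⟩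
  p * p ^ (2 * k) * m      ≡⟨ *-assoc p (p ^ (2 * k)) m ⟩
  p * (p ^ (2 * k) * m)    ∎)
  where
  open ≡-Reasoning
  instance _ = prime⇒nonZero pp
  descend : ∀ k → p * (c * c * p) ≢ p * (p ^ (2 * k) * m)
  -- After one cancellation this reads c² p = m, where p^0 m has computed to `m + 0`.
  descend zero eq = p∤m (divides (c * c) (trans (sym (+-identityʳ m)) (sym (*-cancelˡ-≡ _ _ p eq))))
  descend (suc k) eq = p^odd*m-nonsquare pp p∤m k c (*-cancelʳ-≡ _ _ p (begin
    c * c * p ≡⟨ *-cancelˡ-≡ _ _ p eq ⟩
    p ^ (2 * suc k) * m
      ≡⟨ cong (λ e → p ^ e * m)
           (solve 1 (λ k → con 2 :* (con 1 :+ k) := con 1 :+ (con 2 :* k :+ con 1)) refl k) ⟩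
    p * p ^ (2 * k + 1) * m
      ≡⟨ solve 3 (λ p u m → p :* u :* m := u :* m :* p) refl p (p ^ (2 * k + 1)) m ⟩
    p ^ (2 * k + 1) * m * p ∎))

-- Convolution of graded families of lists.

length-cartesianProductWith : ∀ {A B C : Set} (f : A → B → C) xs ys →
  length (cartesianProductWith f xs ys) ≡ length xs * length ys
length-cartesianProductWith f []       ys = refl
length-cartesianProductWith f (x ∷ xs) ys = trans (length-++ (map (f x) ys))
  (cong₂ _+_ (length-map (f x) ys) (length-cartesianProductWith f xs ys))

module _ {A : Set} where

  -- The combinatorial counterpart of `⊛`: the same recursion with concatenation in place of
  -- multiplication, so that taking lengths turns one into the other.
  _⊗_ : (ℕ → List (List A)) → (ℕ → List (List A)) → ℕ → List (List A)
  (F ⊗ G) zero    = cartesianProductWith _++_ (F 0) (G 0)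
  (F ⊗ G) (suc n) = cartesianProductWith _++_ (F 0) (G (suc n)) ++ ((F ∘ suc) ⊗ G) n

  length-⊗ : ∀ (F G : ℕ → List (List A)) → length ∘ (F ⊗ G) ≗ (length ∘ F) ⊛ (length ∘ G)
  length-⊗ F G zero    = length-cartesianProductWith _++_ (F 0) (G 0)
  length-⊗ F G (suc n) = trans (length-++ (cartesianProductWith _++_ (F 0) (G (suc n))))
    (cong₂ _+_ (length-cartesianProductWith _++_ (F 0) (G (suc n))) (length-⊗ (F ∘ suc) G n))

  ∈-⊗⁺ : ∀ F G {i k} {xs ys : List A} → xs ∈ F i → ys ∈ G k → xs ++ ys ∈ (F ⊗ G) (i + k)
  ∈-⊗⁺ F G {zero}  {zero}  xs∈ ys∈ = ∈-cartesianProductWith⁺ _++_ xs∈ ys∈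
  ∈-⊗⁺ F G {zero}  {suc k} xs∈ ys∈ = ∈-++⁺ˡ (∈-cartesianProductWith⁺ _++_ xs∈ ys∈)
  ∈-⊗⁺ F G {suc i} {k}     xs∈ ys∈ =
    ∈-++⁺ʳ (cartesianProductWith _++_ (F 0) (G (suc (i + k)))) (∈-⊗⁺ (F ∘ suc) G xs∈ ys∈)

  record Split (F G : ℕ → List (List A)) (n : ℕ) (zs : List A) : Set where
    constructor split
    field
      {i k}   : ℕ
      {xs ys} : List A
      xs∈     : xs ∈ F i
      ys∈     : ys ∈ G k
      i+k≡n   : i + k ≡ n
      zs≡     : zs ≡ xs ++ ys

  ∈-⊗⁻ : ∀ F G n {zs} → zs ∈ (F ⊗ G) n → Split F G n zs
  ∈-⊗⁻ F G zero    zs∈ with ∈-cartesianProductWith⁻ _++_ (F 0) (G 0) zs∈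
  ... | _ , _ , xs∈ , ys∈ , eq = split xs∈ ys∈ refl eq
  ∈-⊗⁻ F G (suc n) zs∈ with ∈-++⁻ (cartesianProductWith _++_ (F 0) (G (suc n))) zs∈
  ... | inj₁ zs∈ˡ with ∈-cartesianProductWith⁻ _++_ (F 0) (G (suc n)) zs∈ˡ
  ...   | _ , _ , xs∈ , ys∈ , eq = split xs∈ ys∈ refl eq
  ∈-⊗⁻ F G (suc n) zs∈ | inj₂ zs∈ʳ with ∈-⊗⁻ (F ∘ suc) G n zs∈ʳ
  ... | split xs∈ ys∈ i+k≡n eq = split xs∈ ys∈ (cong suc i+k≡n) eq

  -- The condition under which `⊗` creates no repetitions. The index is part of it because the same
  -- list might occur in several `F i`.
  UniqueSplit : (F G : ℕ → List (List A)) → Set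
  UniqueSplit F G = ∀ {i i′ k k′ xs xs′ ys ys′} → xs ∈ F i → xs′ ∈ F i′ → ys ∈ G k → ys′ ∈ G k′ →
                    xs ++ ys ≡ xs′ ++ ys′ → i ≡ i′ × xs ≡ xs′

  cartesianProductWith-++-unique : ∀ {xss yss : List (List A)} → Unique xss → Unique yss →
    (∀ {xs xs′ ys ys′} → xs ∈ xss → xs′ ∈ xss → ys ∈ yss → ys′ ∈ yss →
      xs ++ ys ≡ xs′ ++ ys′ → xs ≡ xs′) →
    Unique (cartesianProductWith _++_ xss yss)
  cartesianProductWith-++-unique []                         uy sep = []
  cartesianProductWith-++-unique {xs ∷ xss} {yss} (x∉ ∷ ux) uy sep =
    Unique.++⁺ (Unique.map⁺ (++-cancelˡ xs _ _) uy)
      (cartesianProductWith-++-unique ux uy λ p q → sep (there p) (there q))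
      disjoint
    where
    disjoint : ∀ {zs} → ¬ (zs ∈ map (xs ++_) yss × zs ∈ cartesianProductWith _++_ xss yss)
    disjoint (p , q) with ∈-map⁻ (xs ++_) p | ∈-cartesianProductWith⁻ _++_ xss yss q
    ... | ys , ys∈ , eq | xs′ , ys′ , xs′∈ , ys′∈ , eq′ =
      All.lookup x∉ xs′∈ (sep (here refl) (there xs′∈) ys∈ ys′∈ (trans (sym eq) eq′))

  ⊗-unique : ∀ F G → (∀ i → Unique (F i)) → (∀ k → Unique (G k)) → UniqueSplit F G →
             ∀ n → Unique ((F ⊗ G) n)
  ⊗-unique F G uF uG sep zero    = cartesianProductWith-++-unique (uF 0) (uG 0)
    λ p q r s eq → proj₂ (sep p q r s eq)
  ⊗-unique F G uF uG sep (suc n) = Unique.++⁺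
    (cartesianProductWith-++-unique (uF 0) (uG (suc n)) λ p q r s eq → proj₂ (sep p q r s eq))
    (⊗-unique (F ∘ suc) G (uF ∘ suc) uG
      (λ p q r s eq → let i≡ , xs≡ = sep p q r s eq in suc-injective i≡ , xs≡) n)
    disjoint
    where
    disjoint : ∀ {zs} → ¬ (zs ∈ cartesianProductWith _++_ (F 0) (G (suc n)) ×
                           zs ∈ ((F ∘ suc) ⊗ G) n)
    disjoint (p , q) with ∈-cartesianProductWith⁻ _++_ (F 0) (G (suc n)) p | ∈-⊗⁻ (F ∘ suc) G n q
    ... | _ , _ , xs∈ , ys∈ , eq | split xs′∈ ys′∈ _ eq′
      -- The two prefixes would have equal indices, yet one index is 0 and the other a successor.
      with () ← proj₁ (sep xs∈ xs′∈ ys∈ ys′∈ (trans (sym eq) eq′))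

-- The order on parts and on their types.

Type : Set
Type = ℕ × ℕ

typeOf : Part → Type
typeOf (j , c , _) = j , c

weight : List Part → ℕ
weight xs = sum (map size xs)

weight-++ : ∀ xs ys → weight (xs ++ ys) ≡ weight xs + weight ys
weight-++ xs ys = trans (cong sum (map-++ size xs ys)) (sum-++ (map size xs) (map size ys))

_≻_ : Type → Type → Set
(j , c) ≻ (j′ , c′) = j′ < j ⊎ (j′ ≡ j × c′ < c)

≻-irrefl : ∀ {t} → ¬ t ≻ t
≻-irrefl (inj₁ j<j)       = <-irrefl refl j<j
≻-irrefl (inj₂ (_ , c<c)) = <-irrefl refl c<c

≻-trans : ∀ {t u v} → t ≻ u → u ≻ v → t ≻ v
≻-trans (inj₁ p)          (inj₁ q)          = inj₁ (<-trans q p)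
≻-trans (inj₁ p)          (inj₂ (refl , _)) = inj₁ p
≻-trans (inj₂ (refl , _)) (inj₁ q)          = inj₁ q
≻-trans (inj₂ (refl , p)) (inj₂ (refl , q)) = inj₂ (refl , <-trans q p)

≻⇒MayPrecede : ∀ {x y} → typeOf x ≻ typeOf y → x MayPrecede y
≻⇒MayPrecede (inj₁ p) = inj₁ p
≻⇒MayPrecede (inj₂ p) = inj₂ (inj₁ p)

MayPrecede-cases : ∀ {x y} → x MayPrecede y →
  typeOf x ≻ typeOf y ⊎ (typeOf y ≡ typeOf x × proj₂ (proj₂ y) ≡ false)
MayPrecede-cases (inj₁ p)                         = inj₁ (inj₁ p)
MayPrecede-cases (inj₂ (inj₁ p))                  = inj₁ (inj₂ p)
MayPrecede-cases (inj₂ (inj₂ (refl , refl , eq))) = inj₂ (refl , eq)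

-- Transitivity turns the condition on neighbours into one on all pairs, the form in which
-- sortedness is used below.
MayPrecede-trans : ∀ {x y z} → x MayPrecede y → y MayPrecede z → x MayPrecede z
MayPrecede-trans {x} {y} {z} p q with MayPrecede-cases {x} {y} p | MayPrecede-cases {y} {z} q
... | inj₁ p′         | inj₁ q′         = ≻⇒MayPrecede {x} {z} (≻-trans p′ q′)
... | inj₁ p′         | inj₂ (refl , _) = ≻⇒MayPrecede {x} {z} p′
-- `MayPrecede` ignores the overline of its first argument, so equal types of `x` and `y` make `q`
-- the claim itself.
... | inj₂ (refl , _) | _               = q

-- Runs of equal parts.

run : Type → ℕ → List (List Part)
run t       zero    = [] ∷ []
run (j , c) (suc r) = map (λ o → (j , c , o) ∷ replicate r (j , c , false)) (true ∷ false ∷ [])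

∈-run⁺ : ∀ j c o r → (j , c , o) ∷ replicate r (j , c , false) ∈ run (j , c) (suc r)
∈-run⁺ j c true  r = here refl
∈-run⁺ j c false r = there (here refl)

∈-run⁻ : ∀ {j c r xs} → xs ∈ run (j , c) (suc r) →
         ∃ λ o → xs ≡ (j , c , o) ∷ replicate r (j , c , false)
∈-run⁻ (here eq)         = true , eq
∈-run⁻ (there (here eq)) = false , eq

run-unique : ∀ t r → Unique (run t r)
run-unique t zero    = [] ∷ []
run-unique t (suc r) = ((λ ()) ∷ []) ∷ [] ∷ []

run-type : ∀ {t} r {xs} → xs ∈ run t r → All (λ x → typeOf x ≡ t) xs
run-type zero    (here refl) = []
run-type (suc r) xs∈ with ∈-run⁻ xs∈
... | _ , refl = refl ∷ All.replicate⁺ r refl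

run-sorted : ∀ {t} r {xs} → xs ∈ run t r → AllPairs _MayPrecede_ xs
run-sorted zero    (here refl) = []
run-sorted (suc r) xs∈ with ∈-run⁻ xs∈
... | o , refl = sorted o r
  where
  sorted : ∀ {j c} o r → AllPairs _MayPrecede_ ((j , c , o) ∷ replicate r (j , c , false))
  sorted o zero    = [] ∷ []
  sorted o (suc r) = All.replicate⁺ (suc r) (inj₂ (inj₂ (refl , refl , refl))) ∷ sorted false r

run-weight : ∀ {t} r {xs} → xs ∈ run t r → weight xs ≡ r * proj₁ t
run-weight zero    (here refl) = refl
run-weight (suc r) xs∈ with ∈-run⁻ xs∈
... | o , refl = cong (_ +_) (copies r)
  where
  copies : ∀ {j c} r → weight (replicate r (j , c , false)) ≡ r * j
  copies         zero    = refl
  copies {j} (suc r) = cong (j +_) (copies r)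

-- The decision is an explicit argument so that proofs about `runs` can split on it.
runs′ : ∀ t {n} → Dec (proj₁ t ∣ n) → List (List Part)
runs′ t (yes (divides r _)) = run t r
runs′ t (no _)              = []

runs : Type → ℕ → List (List Part)
runs t n = runs′ t (proj₁ t ∣? n)

∈-runs⁻ : ∀ {t n xs} → xs ∈ runs t n → ∃ λ r → xs ∈ run t r × n ≡ r * proj₁ t
∈-runs⁻ {t} {n} = go (proj₁ t ∣? n)
  where
  go : ∀ {xs} (d : Dec (proj₁ t ∣ n)) → xs ∈ runs′ t d → ∃ λ r → xs ∈ run t r × n ≡ r * proj₁ t
  go (yes (divides r eq)) xs∈ = r , xs∈ , eq

∈-runs⁺ : ∀ {t} r {xs} → 1 ≤ proj₁ t → xs ∈ run t r → xs ∈ runs t (r * proj₁ t)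
∈-runs⁺ {t} r {xs} 1≤j xs∈ = go (proj₁ t ∣? (r * proj₁ t))
  where
  go : (d : Dec (proj₁ t ∣ r * proj₁ t)) → xs ∈ runs′ t d
  go (no ∤)               = contradiction (divides r refl) ∤
  go (yes (divides q eq)) =
    subst (λ k → xs ∈ run t k) (*-cancelʳ-≡ r q (proj₁ t) {{>-nonZero 1≤j}} eq) xs∈

runs-unique : ∀ t n → Unique (runs t n)
runs-unique t n = go (proj₁ t ∣? n)
  where
  go : (d : Dec (proj₁ t ∣ n)) → Unique (runs′ t d)
  go (yes (divides r _)) = run-unique t r
  go (no _)              = []

-- A positive multiple of the size is the weight of two runs, with the first copy overlined or not;
-- weight 0 belongs only to the empty run, because the size is positive.
length-runs : ∀ {t} → 1 ≤ proj₁ t → length ∘ runs t ≗ 𝟙 ⊕ (2# ⊛ multiples (proj₁ t))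
length-runs {t} 1≤j zero = go (proj₁ t ∣? 0)
  where
  go : (d : Dec (proj₁ t ∣ 0)) → length (runs′ t d) ≡ 1
  go (no ∤)                    = contradiction (proj₁ t ∣0) ∤
  go (yes (divides zero _))    = refl
  go (yes (divides (suc r) eq)) = contradiction
    (≤-trans 1≤j (m≤m+n _ (r * proj₁ t))) (<⇒≱ (s≤s (≤-reflexive (sym eq))))
length-runs {t} 1≤j (suc n) = trans (go (proj₁ t ∣? suc n))
  (sym (2#-coeff (multiples (proj₁ t)) (suc n)))
  where
  go : (d : Dec (proj₁ t ∣ suc n)) → length (runs′ t d) ≡ 2 * indicator (proj₁ t ∣? suc n)
  go (no ∤)                      = cong (2 *_) (sym (indicator-no (proj₁ t ∣? suc n) ∤))
  go (yes d@(divides (suc r) _)) = cong (2 *_) (sym (indicator-yes (proj₁ t ∣? suc n) d))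

-- Enumeration of overpartitions type by type.

enum : List Type → ℕ → List (List Part)
enum []       zero    = [] ∷ []
enum []       (suc n) = []
enum (t ∷ ts) n       = (runs t ⊗ enum ts) n

length-enum : ∀ {ts} → All (λ t → 1 ≤ proj₁ t) ts → length ∘ enum ts ≗ ∏[1+2 map proj₁ ts ]
length-enum []               zero    = refl
length-enum []               (suc n) = refl
length-enum {t ∷ ts} (p ∷ ps) n = trans (length-⊗ (runs t) (enum ts) n)
  (⊛-cong (length-runs p) (length-enum ps) n)

enum-type : ∀ ts n {xs} → xs ∈ enum ts n → All (λ x → typeOf x ∈ ts) xs
enum-type []       zero (here refl) = []
enum-type (t ∷ ts) n    zs∈ with ∈-⊗⁻ (runs t) (enum ts) n zs∈
... | split {k = k} xs∈ ys∈ _ refl = let r , xs∈run , _ = ∈-runs⁻ {t} xs∈ in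
  All.++⁺ (All.map here (run-type r xs∈run)) (All.map there (enum-type ts k ys∈))

enum-weight : ∀ ts n {xs} → xs ∈ enum ts n → weight xs ≡ n
enum-weight []       zero (here refl) = refl
enum-weight (t ∷ ts) n    zs∈ with ∈-⊗⁻ (runs t) (enum ts) n zs∈
... | split {k = k} {xs} {ys} xs∈ ys∈ eq refl = let r , xs∈run , i≡ = ∈-runs⁻ {t} xs∈ in
  trans (weight-++ xs ys)
    (trans (cong₂ _+_ (trans (run-weight r xs∈run) (sym i≡)) (enum-weight ts k ys∈)) eq)

enum-sorted : ∀ {ts} → AllPairs _≻_ ts → ∀ n {xs} → xs ∈ enum ts n → AllPairs _MayPrecede_ xs
enum-sorted []       zero (here refl) = []
enum-sorted {t ∷ ts} (t≻ ∷ s) n zs∈ with ∈-⊗⁻ (runs t) (enum ts) n zs∈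
... | split {k = k} xs∈ ys∈ _ refl = let r , xs∈run , _ = ∈-runs⁻ {t} xs∈ in
  AllPairs.++⁺ (run-sorted r xs∈run) (enum-sorted s k ys∈)
    (All.map (λ {x} x≡ → All.map (λ {y} y∈ →
        ≻⇒MayPrecede {x} {y} (subst (_≻ typeOf y) (sym x≡) (All.lookup t≻ y∈)))
      (enum-type ts k ys∈)) (run-type r xs∈run))

-- `P` holds on the prefix and fails on the rest, so the first failure marks the cut.
++-unique : ∀ {A : Set} {P : A → Set} {xs xs′ ys ys′ : List A} → All P xs → All P xs′ →
            All (¬_ ∘ P) ys → All (¬_ ∘ P) ys′ → xs ++ ys ≡ xs′ ++ ys′ → xs ≡ xs′
++-unique []       []       _        _        eq   = refl
++-unique []       (p ∷ _)  (¬p ∷ _) _        refl = contradiction p ¬p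
++-unique (p ∷ _)  []       _        (¬p ∷ _) refl = contradiction p ¬p
++-unique (_ ∷ ps) (_ ∷ qs) nys      nys′     eq   = let x≡ , eq′ = ∷-injective eq in
  cong₂ _∷_ x≡ (++-unique ps qs nys nys′ eq′)

enum-unique : ∀ {ts} → AllPairs _≻_ ts → ∀ n → Unique (enum ts n)
enum-unique []            zero    = [] ∷ []
enum-unique []            (suc n) = []
enum-unique {t ∷ ts} (t≻ ∷ s) n   =
  ⊗-unique (runs t) (enum ts) (runs-unique t) (enum-unique s) separated n
  where
  others : ∀ k {ys} → ys ∈ enum ts k → All (λ y → typeOf y ≢ t) ys
  others k ys∈ = All.map
    (λ y∈ y≡t → ≻-irrefl {t} (subst (t ≻_) y≡t (All.lookup t≻ y∈))) (enum-type ts k ys∈)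
  separated : UniqueSplit (runs t) (enum ts)
  separated {k = k} {k′ = k′} xs∈ xs′∈ ys∈ ys′∈ eq with ∈-runs⁻ {t} xs∈ | ∈-runs⁻ {t} xs′∈
  ... | r , xs∈run , refl | r′ , xs′∈run , refl =
    let xs≡ = ++-unique (run-type r xs∈run) (run-type r′ xs′∈run)
                (others k ys∈) (others k′ ys′∈) eq in
    -- The index of a run is its weight, so equal runs have equal indices.
    trans (sym (run-weight r xs∈run)) (trans (cong weight xs≡) (run-weight r′ xs′∈run)) , xs≡

-- Completeness of the enumeration.

-- `P` is left open because the leading block is either a full run or, once its first copy is gone,
-- a block of plain copies.
record Peeled (P : List Part → ℕ → Set) (ts : List Type) (zs : List Part) : Set where
  constructor peeled
  field
    {r}     : ℕ
    {xs ys} : List Part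
    is-run  : P xs r
    types   : All (λ y → typeOf y ∈ ts) ys
    sorted  : AllPairs _MayPrecede_ ys
    zs≡     : zs ≡ xs ++ ys

-- All entries have type at most that of `x`, hence below `t`, so `t` itself cannot occur.
drop-type : ∀ {t ts x xs} → t ≻ typeOf x → All (λ x → typeOf x ∈ t ∷ ts) xs →
            All (x MayPrecede_) xs → All (λ x → typeOf x ∈ ts) xs
drop-type t≻x []           []       = []
drop-type {x = x} t≻x (there p ∷ ps) (_ ∷ qs) = p ∷ drop-type {x = x} t≻x ps qs
drop-type {t} {x = x} {y ∷ _} t≻x (here refl ∷ ps) (q ∷ qs) with MayPrecede-cases {x} {y} q
... | inj₁ x≻t       = contradiction (≻-trans t≻x x≻t) (≻-irrefl {t})
... | inj₂ (eq , _)  = contradiction (subst (typeOf y ≻_) (sym eq) t≻x) (≻-irrefl {t})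

-- The last hypothesis records that a copy of type `(j , c)` came before, so further copies are not
-- overlined; they are split off one by one until another type appears.
peel-plain : ∀ {j c ts xs} → All ((j , c) ≻_) ts →
             All (λ x → typeOf x ∈ (j , c) ∷ ts) xs → AllPairs _MayPrecede_ xs →
             All ((j , c , false) MayPrecede_) xs →
             Peeled (λ ys r → ys ≡ replicate r (j , c , false)) ts xs
peel-plain t≻ [] [] _ = peeled {r = 0} refl [] [] refl
peel-plain {xs = x ∷ _} t≻ (there x∈ ∷ xs∈) (x≥ ∷ s) _ =
  peeled {r = 0} refl (x∈ ∷ drop-type {x = x} (All.lookup t≻ x∈) xs∈ x≥) (x≥ ∷ s) refl
peel-plain {j} {c} {xs = x ∷ xs} t≻ (here refl ∷ xs∈) (x≥ ∷ s) (m ∷ ms)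
  with MayPrecede-cases {j , c , false} {x} m
... | inj₁ t≻t         = contradiction t≻t (≻-irrefl {j , c})
... | inj₂ (_ , refl) with peel-plain t≻ xs∈ s ms
...   | peeled {r = r} refl ys∈ s′ refl = peeled {r = suc r} refl ys∈ s′ refl

peel : ∀ {t ts xs} → All (t ≻_) ts → All (λ x → typeOf x ∈ t ∷ ts) xs → AllPairs _MayPrecede_ xs →
       Peeled (λ ys r → ys ∈ run t r) ts xs
peel t≻ [] [] = peeled {r = 0} (here refl) [] [] refl
peel {xs = x ∷ _} t≻ (there x∈ ∷ xs∈) (x≥ ∷ s) =
  peeled {r = 0} (here refl) (x∈ ∷ drop-type {x = x} (All.lookup t≻ x∈) xs∈ x≥) (x≥ ∷ s) refl
peel {xs = (j , c , o) ∷ _} t≻ (here refl ∷ xs∈) (x≥ ∷ s) with peel-plain t≻ xs∈ s x≥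
... | peeled {r = r} refl ys∈ s′ refl = peeled {r = suc r} (∈-run⁺ j c o r) ys∈ s′ refl

-- Induction on `ts`: the entries of the greatest type form a run at the front, and the rest uses
-- only the remaining types.
∈-enum⁺ : ∀ {ts xs} → AllPairs _≻_ ts → All (λ t → 1 ≤ proj₁ t) ts →
          All (λ x → typeOf x ∈ ts) xs → AllPairs _MayPrecede_ xs → xs ∈ enum ts (weight xs)
∈-enum⁺ {[]}     []       []        []      s = here refl
∈-enum⁺ {t ∷ ts} (t≻ ∷ st) (1≤j ∷ ps) xs∈ s with peel t≻ xs∈ s
... | peeled {r = r} {xs} {ys} run∈ ys∈ s′ refl = subst (λ n → xs ++ ys ∈ enum (t ∷ ts) n)
  (trans (cong (_+ weight ys) (sym (run-weight r run∈))) (sym (weight-++ xs ys)))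
  (∈-⊗⁺ (runs t) (enum ts) {r * proj₁ t} (∈-runs⁺ r 1≤j run∈) (∈-enum⁺ st ps ys∈ s′))

-- The generating function of `ā s`.

types : ℕ → List ℕ → List Type
types s []       = []
types s (j ∷ js) = map (j ,_) (downFrom (colours s j)) ++ types s js

∈-types⁺ : ∀ s {js j c} → j ∈ js → c < colours s j → (j , c) ∈ types s js
∈-types⁺ s {j ∷ js} (here refl) c< = ∈-++⁺ˡ (∈-map⁺ (j ,_) (∈-downFrom⁺ c<))
∈-types⁺ s {j ∷ js} (there j∈)  c< = ∈-++⁺ʳ (map (j ,_) (downFrom (colours s j))) (∈-types⁺ s j∈ c<)

∈-types⁻ : ∀ s js {j c} → (j , c) ∈ types s js → j ∈ js × c < colours s j
∈-types⁻ s (j ∷ js) t∈ with ∈-++⁻ (map (j ,_) (downFrom (colours s j))) t∈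
... | inj₂ t∈ʳ = let j∈ , c< = ∈-types⁻ s js t∈ʳ in there j∈ , c<
... | inj₁ t∈ˡ with ∈-map⁻ (j ,_) t∈ˡ
...   | _ , c∈ , refl = here refl , ∈-downFrom⁻ c∈

types-sorted : ∀ s {js} → AllPairs (λ i j → j < i) js → AllPairs _≻_ (types s js)
types-sorted s []              = []
types-sorted s {j ∷ js} (j> ∷ js>) = AllPairs.++⁺
  (AllPairs.map⁺ (AllPairs.applyDownFrom⁺₁ _ (colours s j) λ c′<c _ → inj₂ (refl , c′<c)))
  (types-sorted s js>)
  (All.map⁺ (All.tabulate λ _ → All.tabulate λ t∈ →
    inj₁ (All.lookup j> (proj₁ (∈-types⁻ s js t∈)))))

sizes-sorted : ∀ b → AllPairs (λ i j → j < i) (sizes b)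
sizes-sorted b = AllPairs.map⁺ (AllPairs.applyDownFrom⁺₁ _ b λ j<i _ → s≤s j<i)

∈-sizes⁺ : ∀ {b j} → 1 ≤ j → j ≤ b → j ∈ sizes b
∈-sizes⁺ (s≤s _) j≤b = ∈-map⁺ suc (∈-downFrom⁺ j≤b)

∈-sizes⁻ : ∀ {b j} → j ∈ sizes b → 1 ≤ j
∈-sizes⁻ j∈ with ∈-map⁻ suc j∈
... | _ , _ , refl = s≤s z≤n

size≤weight : ∀ xs → All (λ x → size x ≤ weight xs) xs
size≤weight []       = []
size≤weight (x ∷ xs) = m≤m+n (size x) _ ∷
  All.map (λ p → ≤-trans p (m≤n+m _ (size x))) (size≤weight xs)

-- `overpartitions` and `enum` give lists without repetitions that have the same elements, so one is
-- a permutation of the other. Sizes up to `n` suffice, as no part exceeds the weight.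
ā-generating : ∀ s n → ā s n ≡ ∏[1+2 map proj₁ (types s (sizes n)) ] n
ā-generating s n = trans
  (↭-length (∼bag⇒↭ (unique∧set⇒bag (overpartitions-unique s n) (enum-unique sorted n)
    λ {xs} → mk⇔ to from)))
  (length-enum positive n)
  where
  ts = types s (sizes n)
  sorted : AllPairs _≻_ ts
  sorted = types-sorted s (sizes-sorted n)
  positive : All (λ t → 1 ≤ proj₁ t) ts
  positive = All.tabulate λ t∈ → ∈-sizes⁻ (proj₁ (∈-types⁻ s (sizes n) t∈))
  to : ∀ {xs} → xs ∈ overpartitions s n → xs ∈ enum ts n
  to {xs} xs∈ with Equivalence.to (∈-overpartitions s n xs) xs∈
  ... | valid , linked , refl = ∈-enum⁺ sorted positive
    (All.zipWith (λ { ((1≤j , c<) , j≤) → ∈-types⁺ s (∈-sizes⁺ 1≤j j≤) c< })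
      (valid , size≤weight xs))
    (Linked⇒AllPairs (λ {x} {y} {z} → MayPrecede-trans {x} {y} {z}) linked)
  from : ∀ {xs} → xs ∈ enum ts n → xs ∈ overpartitions s n
  from {xs} xs∈ = Equivalence.from (∈-overpartitions s n xs)
    ( All.map (λ t∈ → let j∈ , c< = ∈-types⁻ s (sizes n) t∈ in ∈-sizes⁻ j∈ , c<)
        (enum-type ts n xs∈)
    , AllPairs⇒Linked (enum-sorted sorted n xs∈)
    , enum-weight ts n xs∈)

-- Factorisation into odd and even sizes.

colours-odd : ∀ s {j} → 2 ∤ j → colours s j ≡ s
colours-odd s {j} 2∤j = cong (if_then 1 else s) (dec-false (2 ∣? j) 2∤j)

colours-even : ∀ s {j} → 2 ∣ j → colours s j ≡ 1
colours-even s {j} 2∣j = cong (if_then 1 else s) (dec-true (2 ∣? j) 2∣j)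

∏-colours : ∀ j k ts → ∏[1+2 map proj₁ (map (j ,_) (downFrom k) ++ ts) ] ≗
                       ((𝟙 ⊕ (2# ⊛ multiples j)) ^^ k) ⊛ ∏[1+2 map proj₁ ts ]
∏-colours j zero    ts = 𝕊.sym (𝕊.*-identityˡ ∏[1+2 map proj₁ ts ])
∏-colours j (suc k) ts = 𝕊.trans (⊛-cong {f} (λ _ → refl) (∏-colours j k ts))
  (𝕊.sym (𝕊.*-assoc f (f ^^ k) ∏[1+2 map proj₁ ts ]))
  where
  f = 𝟙 ⊕ (2# ⊛ multiples j)

-- An odd size contributes one factor per colour, `s` in all, and an even size a single one.
∏-types : ∀ s js → ∏[1+2 map proj₁ (types s js) ] ≗
                   (∏[1+2 filter odd? js ] ^^ s) ⊛ ∏[1+2 filter (2 ∣?_) js ]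
∏-types s [] = 𝕊.sym (𝕊.trans (𝕊.*-identityʳ (𝟙 ^^ s)) (𝟙^ s))
  where
  𝟙^ : ∀ k → 𝟙 ^^ k ≗ 𝟙
  𝟙^ zero    = λ _ → refl
  𝟙^ (suc k) = 𝕊.trans (𝕊.*-identityˡ (𝟙 ^^ k)) (𝟙^ k)
∏-types s (j ∷ js) = 𝕊.trans (∏-colours j (colours s j) (types s js))
  (𝕊.trans (⊛-cong {f ^^ colours s j} (λ _ → refl) (∏-types s js)) (step (2 ∣? j)))
  where
  open ≈-Reasoning 𝕊.setoid
  f O E : Series
  f = 𝟙 ⊕ (2# ⊛ multiples j)
  O = ∏[1+2 filter odd? js ]
  E = ∏[1+2 filter (2 ∣?_) js ]
  step : Dec (2 ∣ j) → (f ^^ colours s j) ⊛ ((O ^^ s) ⊛ E) ≗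
         (∏[1+2 filter odd? (j ∷ js) ] ^^ s) ⊛ ∏[1+2 filter (2 ∣?_) (j ∷ js) ]
  step (no 2∤j) rewrite colours-odd s 2∤j | filter-accept odd? {xs = js} 2∤j
                      | filter-reject (2 ∣?_) {xs = js} 2∤j = begin
    (f ^^ s) ⊛ ((O ^^ s) ⊛ E) ≈⟨ 𝕊.*-assoc (f ^^ s) (O ^^ s) E ⟨
    ((f ^^ s) ⊛ (O ^^ s)) ⊛ E ≈⟨ ⊛-cong (^-distrib-* f O s) (λ _ → refl) ⟨
    ((f ⊛ O) ^^ s) ⊛ E        ∎
  step (yes 2∣j) rewrite colours-even s 2∣j | filter-reject odd? {xs = js} (λ 2∤j → 2∤j 2∣j)
                       | filter-accept (2 ∣?_) {xs = js} 2∣j = begin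
    (f ⊛ 𝟙) ⊛ ((O ^^ s) ⊛ E) ≈⟨ ⊛-cong (𝕊.*-identityʳ f) (λ _ → refl) ⟩
    f ⊛ ((O ^^ s) ⊛ E)       ≈⟨ x∙yz≈y∙xz f (O ^^ s) E ⟩
    (O ^^ s) ⊛ (f ⊛ E)       ∎

-- Divisibility at odd nonsquare arguments.

2^-divides-ā : ∀ m a N → 2 ∤ N → (∀ b → b * b ≢ N) → 2 ^ (2 + m) ∣ ā (2 ^ m * a) N
2^-divides-ā m a N odd nonsquare = subst (2 ^ (2 + m) ∣_) (sym eq)
  (congruent1-coeff {f = (O ^^ (2 ^ m)) ^^ a} {e = e} odd
    -- Squaring `m` times lifts the level from 0 to `m`, and the power `a` preserves it.
    (congruent1-^ a (congruent1-^2^ m odd (∏-odd-congruent1 N odd nonsquare)))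
    λ n 2∤n → trans (sym (E≗ n)) (∏-evenSupported (All.all-filter (2 ∣?_) (sizes N)) n 2∤n))
  where
  open ≡-Reasoning
  evens : List ℕ
  evens = filter (2 ∣?_) (sizes N)
  O e : Series
  O = ∏[1+2 filter odd? (sizes N) ]
  -- This is (E - 1) / 2 for the product E over the even sizes, as read off from `∏-1+2*`.
  e = ∑ (map multiples evens) ⊕ (2# ⊛ proj₁ (∏-1+2* (map multiples evens)))
  E≗ : ∏[1+2 evens ] ≗ 𝟙 ⊕ (2# ⊛ e)
  E≗ = proj₂ (∏-1+2* (map multiples evens))
  eq : ā (2 ^ m * a) N ≡ (((O ^^ (2 ^ m)) ^^ a) ⊛ (𝟙 ⊕ (2# ⊛ e))) N
  eq = begin
    ā (2 ^ m * a) N                                        ≡⟨ ā-generating (2 ^ m * a) N ⟩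
    ∏[1+2 map proj₁ (types (2 ^ m * a) (sizes N)) ] N      ≡⟨ ∏-types (2 ^ m * a) (sizes N) N ⟩
    ((O ^^ (2 ^ m * a)) ⊛ ∏[1+2 evens ]) N
      ≡⟨ ⊛-cong (𝕊.sym (^-assocʳ O (2 ^ m) a)) E≗ N ⟩
    (((O ^^ (2 ^ m)) ^^ a) ⊛ (𝟙 ⊕ (2# ⊛ e))) N             ∎

odd-^ : ∀ {p} → 2 ∤ p → ∀ k → 2 ∤ p ^ k
odd-^ 2∤p zero    2∣1 = contradiction (∣1⇒≡1 2∣1) λ ()
odd-^ {p} 2∤p (suc k) 2∣ with euclidsLemma p (p ^ k) prime[2] 2∣
... | inj₁ 2∣p  = 2∤p 2∣p
... | inj₂ 2∣p^ = odd-^ 2∤p k 2∣p^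

theorem1p1 : (p m α β : ℕ) → Prime p → 3 ≤ p → 1 ≤ m → 1 ≤ α → 1 ≤ β → 2 ∤ α →
    (2 ∣ ā (2 ^ m * α) p →
    (n k : ℕ) → p ∤ (2 * n + 1) →
    2 ^ (m + 2) ∣ ā (2 ^ m * α) (2 * p ^ (2 * k + 1) * n + p ^ (2 * k + 1)))
    ×
    (2 ∣ ā (2 * β + 1) p →
    (n k : ℕ) → p ∤ (2 * n + 1) →
    4 ∣ ā (2 * β + 1) (2 * p ^ (2 * k + 1) * n + p ^ (2 * k + 1)))
theorem1p1 p m α β pp 3≤p _ _ _ _ =
  (λ _ n k p∤ → subst (_∣ ā (2 ^ m * α) (2 * p ^ (2 * k + 1) * n + p ^ (2 * k + 1)))
    (cong (2 ^_) (+-comm 2 m)) (divides-ā m α n k p∤)) ,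
  -- At `m = 0` the number of colours appears as `1 * (2 * β + 1)`.
  (λ _ n k p∤ → subst (λ s → 4 ∣ ā s (2 * p ^ (2 * k + 1) * n + p ^ (2 * k + 1)))
    (*-identityˡ (2 * β + 1)) (divides-ā 0 (2 * β + 1) n k p∤))
  where
  2∤p : 2 ∤ p
  2∤p 2∣p with prime⇒irreducible pp 2∣p
  -- The divisor 2 of `p` would be 1, which is absurd by itself, or `p`, which contradicts `3 ≤ p`.
  ... | inj₂ refl = contradiction 3≤p λ { (s≤s (s≤s ())) }
  divides-ā : ∀ m a n k → p ∤ (2 * n + 1) →
              2 ^ (2 + m) ∣ ā (2 ^ m * a) (2 * p ^ (2 * k + 1) * n + p ^ (2 * k + 1))
  divides-ā m a n k p∤ = subst (λ N → 2 ^ (2 + m) ∣ ā (2 ^ m * a) N) factored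
    (2^-divides-ā m a (p ^ (2 * k + 1) * (2 * n + 1)) odd (p^odd*m-nonsquare pp p∤ k))
    where
    factored : p ^ (2 * k + 1) * (2 * n + 1) ≡ 2 * p ^ (2 * k + 1) * n + p ^ (2 * k + 1)
    factored = solve 2 (λ q n → q :* (con 2 :* n :+ con 1) := con 2 :* q :* n :+ q) refl
      (p ^ (2 * k + 1)) n
    odd : 2 ∤ p ^ (2 * k + 1) * (2 * n + 1)
    odd 2∣ with euclidsLemma (p ^ (2 * k + 1)) (2 * n + 1) prime[2] 2∣
    ... | inj₁ 2∣p^   = odd-^ 2∤p (2 * k + 1) 2∣p^
    ... | inj₂ 2∣2n+1 = contradiction (∣1⇒≡1 (∣m+n∣m⇒∣n 2∣2n+1 (m∣m*n n))) λ ()
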